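{- There exists a digraph $D=(V,A)$ with integral arc capacities $c\in\mathbb{Z}^A_{\ge0}$ and an integral balance function $b\colon V\to\mathbb{Z}$, $\sum_{v\in V}b(v)=0$, that admits a feasible unsplittable $b$-transshipment but does not admit any feasible integral unsplittable $b$-transshipment (i.e., one in which all paths carry integral flow values).
   Context: A vertex $v$ is a source if $b(v)>0$ and a sink if $b(v)<0$. A $b$-transshipment is a vector $x\in\mathbb{R}^A_{\ge0}$ whose outflow minus inflow at each vertex $v$ equals $b(v)$; it is feasible if $x_a\le c_a$ for all $a\in A$. An unsplittable $b$-transshipment is a $b$-transshipment together with a path decomposition consisting only of source--sink paths, with at most one path for each source--sink pair. Digraphs may have parallel arcs. -}

module Defs where

open import Algebra.Bundles.Raw using (RawMonoid)
import Algebra.Definitions.RawMonoid as RawMonoidDefs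
open import Algebra.Bundles using (AbelianGroup)
import Algebra.Properties.CommutativeSemigroup as CommutativeSemigroupProperties
open import Data.Bool.Base using (if_then_else_)
open import Data.Fin.Base using (Fin)
open import Data.Fin.Properties using (_≟_)
open import Data.Integer.Base as ℤ using (ℤ; +_)
open import Data.List.Base using (List; []; _∷_; map)
open import Data.List.Membership.DecPropositional using (_∈?_)
open import Data.List.Relation.Unary.Unique.Propositional using (Unique)
open import Data.Nat.Base as ℕ using (ℕ; _⊔_)
import Data.Nat.Properties as ℕ
open import Data.Product.Base using (∃-syntax; _×_; _,_)
open import Data.Rational.Base as ℚ using (ℚ; 0ℚ; ½; ∣_∣)
import Data.Rational.Properties as ℚ
open import Function.Definitions using (Injective)
open import Level using (0ℓ)
open import Relation.Binary.PropositionalEquality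
  using (_≡_; sym; trans; cong; subst)
open import Relation.Nullary.Decidable.Core using (does)

------------------------------------------------------------------------
-- Real numbers: Cauchy sequences of rationals, compared up to null
-- sequences. Only the ordered additive group structure is needed.

IsCauchy : (ℕ → ℚ) → Set
IsCauchy x = ∀ ε → 0ℚ ℚ.< ε →
  ∃[ N ] (∀ m n → N ℕ.≤ m → N ℕ.≤ n → ∣ x m ℚ.- x n ∣ ℚ.< ε)

record ℝ : Set where
  constructor mkℝ
  field
    seq    : ℕ → ℚ
    cauchy : IsCauchy seq

open ℝ public

infix 4 _≃ᴿ_ _≤ᴿ_

_≃ᴿ_ : ℝ → ℝ → Set
x ≃ᴿ y = ∀ ε → 0ℚ ℚ.< ε →
  ∃[ N ] (∀ n → N ℕ.≤ n → ∣ seq x n ℚ.- seq y n ∣ ℚ.< ε)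

_≤ᴿ_ : ℝ → ℝ → Set
x ≤ᴿ y = ∀ ε → 0ℚ ℚ.< ε →
  ∃[ N ] (∀ n → N ℕ.≤ n → seq x n ℚ.< seq y n ℚ.+ ε)

fromℚ : ℚ → ℝ
fromℚ q = mkℝ (λ _ → q) λ ε 0<ε →
  0 , λ _ _ _ _ → subst (ℚ._< ε) (sym (cong ∣_∣ (ℚ.+-inverseʳ q))) 0<ε

fromℤ : ℤ → ℝ
fromℤ z = fromℚ (z ℚ./ 1)

0ᴿ : ℝ
0ᴿ = fromℚ 0ℚ

private
  open CommutativeSemigroupProperties
    (AbelianGroup.commutativeSemigroup ℚ.+-0-abelianGroup) using (interchange)

  0<½*_ : ∀ {ε} → 0ℚ ℚ.< ε → 0ℚ ℚ.< ½ ℚ.* ε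
  0<½*_ {ε} 0<ε =
    ℚ.positive⁻¹ _ ⦃ ℚ.pos*pos⇒pos ½ ε ⦃ ℚ.positive 0<ε ⦄ ⦄

  halves : ∀ ε → ½ ℚ.* ε ℚ.+ ½ ℚ.* ε ≡ ε
  halves ε = trans (sym (ℚ.*-distribʳ-+ ε ½ ½)) (ℚ.*-identityˡ ε)

  +-‿-interchange : ∀ a b c d →
    (a ℚ.+ b) ℚ.- (c ℚ.+ d) ≡ (a ℚ.- c) ℚ.+ (b ℚ.- d)
  +-‿-interchange a b c d = trans
    (cong ((a ℚ.+ b) ℚ.+_) (ℚ.neg-distrib-+ c d))
    (interchange a b (ℚ.- c) (ℚ.- d))

infixl 6 _+ᴿ_ _-ᴿ_
infix  8 -ᴿ_

_+ᴿ_ : ℝ → ℝ → ℝ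
x +ᴿ y = mkℝ (λ n → seq x n ℚ.+ seq y n) +-cauchy
  where
  +-cauchy : IsCauchy (λ n → seq x n ℚ.+ seq y n)
  +-cauchy ε 0<ε
    with M , p ← cauchy x (½ ℚ.* ε) (0<½* 0<ε)
       | N , q ← cauchy y (½ ℚ.* ε) (0<½* 0<ε)
    = M ⊔ N , λ m n M⊔N≤m M⊔N≤n → begin-strict
      ∣ (seq x m ℚ.+ seq y m) ℚ.- (seq x n ℚ.+ seq y n) ∣
        ≡⟨ cong ∣_∣ (+-‿-interchange (seq x m) (seq y m) (seq x n) (seq y n)) ⟩
      ∣ (seq x m ℚ.- seq x n) ℚ.+ (seq y m ℚ.- seq y n) ∣
        ≤⟨ ℚ.∣p+q∣≤∣p∣+∣q∣ (seq x m ℚ.- seq x n) (seq y m ℚ.- seq y n) ⟩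
      ∣ seq x m ℚ.- seq x n ∣ ℚ.+ ∣ seq y m ℚ.- seq y n ∣
        <⟨ ℚ.+-mono-<
             (p m n (ℕ.m⊔n≤o⇒m≤o M N M⊔N≤m) (ℕ.m⊔n≤o⇒m≤o M N M⊔N≤n))
             (q m n (ℕ.m⊔n≤o⇒n≤o M N M⊔N≤m) (ℕ.m⊔n≤o⇒n≤o M N M⊔N≤n)) ⟩
      ½ ℚ.* ε ℚ.+ ½ ℚ.* ε
        ≡⟨ halves ε ⟩
      ε ∎
    where open ℚ.≤-Reasoning

-ᴿ_ : ℝ → ℝ
-ᴿ x = mkℝ (λ n → ℚ.- seq x n) neg-cauchy
  where
  neg-cauchy : IsCauchy (λ n → ℚ.- seq x n)
  neg-cauchy ε 0<ε with N , p ← cauchy x ε 0<ε =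
    N , λ m n N≤m N≤n → subst (ℚ._< ε)
      (trans (sym (ℚ.∣-p∣≡∣p∣ (seq x m ℚ.- seq x n)))
             (cong ∣_∣ (ℚ.neg-distrib-+ (seq x m) (ℚ.- seq x n))))
      (p m n N≤m N≤n)

_-ᴿ_ : ℝ → ℝ → ℝ
x -ᴿ y = x +ᴿ (-ᴿ y)

ℝ-+-rawMonoid : RawMonoid 0ℓ 0ℓ
ℝ-+-rawMonoid = record { Carrier = ℝ ; _≈_ = _≃ᴿ_ ; _∙_ = _+ᴿ_ ; ε = 0ᴿ }

open RawMonoidDefs ℝ-+-rawMonoid public using () renaming (sum to sumᴿ)
open RawMonoidDefs ℤ.+-0-rawMonoid public using () renaming (sum to sumᶻ)

IsIntegral : ℝ → Set
IsIntegral x = ∃[ z ] (x ≃ᴿ fromℤ z)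

------------------------------------------------------------------------
-- Digraphs and paths

-- Arcs carry their own identity, so parallel arcs are possible.
record Digraph : Set where
  field
    #vertices : ℕ
    #arcs     : ℕ
    tail head : Fin #arcs → Fin #vertices

  Vertex : Set
  Vertex = Fin #vertices

  Arc : Set
  Arc = Fin #arcs

open Digraph public using (Vertex; Arc)

module _ (D : Digraph) where
  open Digraph D using (#vertices; #arcs; tail; head)

  IsWalk : Vertex D → List (Arc D) → Vertex D → Set
  IsWalk s []       t = s ≡ t
  IsWalk s (a ∷ as) t = tail a ≡ s × IsWalk (head a) as t

  record Path : Set where
    field
      start  : Vertex D
      end    : Vertex D
      arcs   : List (Arc D)
      isWalk : IsWalk start arcs end
      -- The list of all visited vertices, in order, has no repetition.
      simple : Unique (start ∷ map head arcs)

    endpoints : Vertex D × Vertex D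
    endpoints = start , end

  open Path public

------------------------------------------------------------------------
-- Transshipments

  outflow inflow : (Arc D → ℝ) → Vertex D → ℝ
  outflow x v = sumᴿ λ a → if does (tail a ≟ v) then x a else 0ᴿ
  inflow  x v = sumᴿ λ a → if does (head a ≟ v) then x a else 0ᴿ

  Source Sink : (Vertex D → ℤ) → Vertex D → Set
  Source b v = ℤ.0ℤ ℤ.< b v
  Sink   b v = b v ℤ.< ℤ.0ℤ

  record IsTransshipment (b : Vertex D → ℤ) (x : Arc D → ℝ) : Set where
    field
      nonNegative : ∀ a → 0ᴿ ≤ᴿ x a
      balance     : ∀ v → outflow x v -ᴿ inflow x v ≃ᴿ fromℤ (b v)

  IsFeasible : (Arc D → ℕ) → (Arc D → ℝ) → Set
  IsFeasible c x = ∀ a → x a ≤ᴿ fromℤ (+ c a)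

  record PathDecomposition (x : Arc D → ℝ) : Set where
    field
      #paths      : ℕ
      path        : Fin #paths → Path
      value       : Fin #paths → ℝ
      nonNegative : ∀ i → 0ᴿ ≤ᴿ value i
      decomposes  : ∀ a →
        x a ≃ᴿ sumᴿ λ i → if does (_∈?_ _≟_ a (arcs (path i))) then value i else 0ᴿ

  record UnsplittableTransshipment (b : Vertex D → ℤ) : Set where
    field
      flow            : Arc D → ℝ
      isTransshipment : IsTransshipment b flow
      decomposition   : PathDecomposition flow

    open PathDecomposition decomposition public using (#paths; path; value)

    field
      fromSource     : ∀ i → Source b (start (path i))
      toSink         : ∀ i → Sink b (end (path i))
      onePathPerPair : Injective _≡_ _≡_ (λ i → endpoints (path i))

  open UnsplittableTransshipment public
    using (flow; isTransshipment; decomposition; fromSource; toSink; onePathPerPair)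

  IsIntegralUnsplittable : ∀ {b} → UnsplittableTransshipment b → Set
  IsIntegralUnsplittable y = ∀ i → IsIntegral (UnsplittableTransshipment.value y i)

{-# OPTIONS --safe #-}

-- Two sources of supply 3 and two sinks of demand 3 are joined through two
-- gates: source–gate and gate–sink arcs have capacity 2, each gate has capacity 3.
-- Sending 3/2 along one path per pair, with the gates chosen crosswise, is feasible.
-- Conversely, capacity 2 forces each source and each sink to use both gates, so
-- every pair uses one gate and the choice is crosswise. Then the balances at the
-- terminals make the two values x₁₁ and x₂₂ equal, while the saturated gate gives
-- x₁₁ + x₂₂ = 3, so no integral values exist.
module Submission where

open import Defs
open import Data.Integer using (ℤ; 0ℤ)
open import Data.Nat using (ℕ)
open import Data.Product using (Σ-syntax; ∃-syntax; _×_)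
open import Relation.Binary.PropositionalEquality using (_≡_)
open import Relation.Nullary using (¬_)

import Algebra.Properties.AbelianGroup as AbelianGroupProperties
import Algebra.Properties.CommutativeMonoid.Sum as CommutativeMonoidSum
import Algebra.Properties.CommutativeSemigroup as CommutativeSemigroupProperties
open import Algebra.Bundles using (AbelianGroup)
open import Data.Bool.Base using (Bool; true; false; if_then_else_)
open import Data.Empty using (⊥; ⊥-elim)
open import Data.Fin.Base
  using (Fin; zero; suc; toℕ; fromℕ<; combine; quotient; remainder; finToFun; funToFin)
open import Data.Fin.Patterns
open import Data.Fin.Properties
  using (_≟_; all?; any?; toℕ-fromℕ<; remQuot-combine; finToFun-funToFin)
open import Data.Integer as ℤ using (+_; -[1+_])
import Data.Integer.Properties as ℤ
open import Data.List.Base using (List; []; _∷_; map)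
open import Data.List.Membership.DecPropositional using (_∈?_)
open import Data.List.Membership.Propositional using (_∈_)
open import Data.List.Relation.Unary.Any using (here)
open import Data.List.Relation.Unary.Unique.DecPropositional using (unique?)
open import Data.Nat as ℕ using (_^_; s≤s)
import Data.Nat.Properties as ℕ
open import Data.Product using (_,_; proj₁; proj₂)
open import Data.Product.Properties using (≡-dec)
open import Data.Rational as ℚ using (ℚ; 0ℚ; 1ℚ; ½)
import Data.Rational.Properties as ℚ
open import Data.Rational.Unnormalised.Base as ℚᵘ using (mkℚᵘ; *≡*)
import Data.Rational.Unnormalised.Properties as ℚᵘ
open import Data.Vec.Base as Vec using ([]; _∷_)
open import Function.Base using (_∘_)
open import Function.Definitions using (Injective)
open import Relation.Binary.PropositionalEquality
  using (refl; sym; trans; cong; cong₂; subst; subst₂; module ≡-Reasoning)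
open import Relation.Nullary.Decidable
  using (Dec; yes; no; does; from-yes; dec-true; ¬?; _→-dec_; _×-dec_)

-- The order on the reals

private
  0<½* : ∀ {ε} → 0ℚ ℚ.< ε → 0ℚ ℚ.< ½ ℚ.* ε
  0<½* {ε} 0<ε =
    ℚ.positive⁻¹ _ ⦃ ℚ.pos*pos⇒pos ½ ε ⦃ ℚ.positive 0<ε ⦄ ⦄

  halves : ∀ ε → ½ ℚ.* ε ℚ.+ ½ ℚ.* ε ≡ ε
  halves ε = trans (sym (ℚ.*-distribʳ-+ ε ½ ½)) (ℚ.*-identityˡ ε)

open CommutativeSemigroupProperties
  (AbelianGroup.commutativeSemigroup ℚ.+-0-abelianGroup)
  using (interchange)

seq-≤⇒≤ᴿ : ∀ x y → (∀ n → seq x n ℚ.≤ seq y n) → x ≤ᴿ y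
seq-≤⇒≤ᴿ x y x≤y ε 0<ε = 0 , λ n _ → begin-strict
  seq x n             ≤⟨ x≤y n ⟩
  seq y n             ≡⟨ ℚ.+-identityʳ _ ⟨
  seq y n ℚ.+ 0ℚ      <⟨ ℚ.+-monoʳ-< (seq y n) 0<ε ⟩
  seq y n ℚ.+ ε       ∎
  where open ℚ.≤-Reasoning

seq-≡⇒≃ᴿ : ∀ x y → (∀ n → seq x n ≡ seq y n) → x ≃ᴿ y
seq-≡⇒≃ᴿ x y x≡y ε 0<ε = 0 , λ n _ → subst (ℚ._< ε)
  (sym (cong ℚ.∣_∣ (trans (cong (ℚ._- seq y n) (x≡y n)) (ℚ.+-inverseʳ (seq y n)))))
  0<ε

p≤∣p∣ : ∀ p → p ℚ.≤ ℚ.∣ p ∣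
p≤∣p∣ (ℚ.mkℚ (+ _)    _ _) = ℚ.≤-refl
p≤∣p∣ p@(ℚ.mkℚ -[1+ _ ] _ _) = ℚ.<⇒≤ (ℚ.neg<pos p ℚ.∣ p ∣)

≃ᴿ⇒≤ᴿ : ∀ x y → x ≃ᴿ y → x ≤ᴿ y
≃ᴿ⇒≤ᴿ x y x≃y ε 0<ε with N , h ← x≃y ε 0<ε = N , λ n N≤n → begin-strict
  seq x n
    ≡⟨ ℚ.+-identityʳ _ ⟨
  seq x n ℚ.+ 0ℚ
    ≡⟨ cong (seq x n ℚ.+_) (ℚ.+-inverseˡ (seq y n)) ⟨
  seq x n ℚ.+ (ℚ.- seq y n ℚ.+ seq y n)
    ≡⟨ ℚ.+-assoc (seq x n) _ _ ⟨
  (seq x n ℚ.- seq y n) ℚ.+ seq y n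
    ≤⟨ ℚ.+-monoˡ-≤ (seq y n) (p≤∣p∣ (seq x n ℚ.- seq y n)) ⟩
  ℚ.∣ seq x n ℚ.- seq y n ∣ ℚ.+ seq y n
    <⟨ ℚ.+-monoˡ-< (seq y n) (h n N≤n) ⟩
  ε ℚ.+ seq y n
    ≡⟨ ℚ.+-comm ε (seq y n) ⟩
  seq y n ℚ.+ ε ∎
  where open ℚ.≤-Reasoning

≃ᴿ-sym : ∀ x y → x ≃ᴿ y → y ≃ᴿ x
≃ᴿ-sym x y x≃y ε 0<ε with N , h ← x≃y ε 0<ε =
  N , λ n N≤n → subst (ℚ._< ε) 
    (trans (sym (ℚ.∣-p∣≡∣p∣ (seq x n ℚ.- seq y n)))
           (cong ℚ.∣_∣ (⁻¹-anti-homo‿- (seq x n) (seq y n))))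
    (h n N≤n)
  where open AbelianGroupProperties ℚ.+-0-abelianGroup using (⁻¹-anti-homo‿-)

≤ᴿ-trans : ∀ x y z → x ≤ᴿ y → y ≤ᴿ z → x ≤ᴿ z
≤ᴿ-trans x y z x≤y y≤z ε 0<ε
  with M , p ← x≤y (½ ℚ.* ε) (0<½* 0<ε) | N , q ← y≤z (½ ℚ.* ε) (0<½* 0<ε)
  = M ℕ.⊔ N , λ n M⊔N≤n → begin-strict
    seq x n
      <⟨ p n (ℕ.m⊔n≤o⇒m≤o M N M⊔N≤n) ⟩
    seq y n ℚ.+ ½ ℚ.* ε
      <⟨ ℚ.+-monoˡ-< (½ ℚ.* ε) (q n (ℕ.m⊔n≤o⇒n≤o M N M⊔N≤n)) ⟩
    (seq z n ℚ.+ ½ ℚ.* ε) ℚ.+ ½ ℚ.* ε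
      ≡⟨ ℚ.+-assoc (seq z n) _ _ ⟩
    seq z n ℚ.+ (½ ℚ.* ε ℚ.+ ½ ℚ.* ε)
      ≡⟨ cong (seq z n ℚ.+_) (halves ε) ⟩
    seq z n ℚ.+ ε ∎
  where open ℚ.≤-Reasoning

+ᴿ-mono-≤ᴿ : ∀ x y u v → x ≤ᴿ y → u ≤ᴿ v → x +ᴿ u ≤ᴿ y +ᴿ v
+ᴿ-mono-≤ᴿ x y u v x≤y u≤v ε 0<ε
  with M , p ← x≤y (½ ℚ.* ε) (0<½* 0<ε) | N , q ← u≤v (½ ℚ.* ε) (0<½* 0<ε)
  = M ℕ.⊔ N , λ n M⊔N≤n → begin-strict
    seq x n ℚ.+ seq u n
      <⟨ ℚ.+-mono-< (p n (ℕ.m⊔n≤o⇒m≤o M N M⊔N≤n)) (q n (ℕ.m⊔n≤o⇒n≤o M N M⊔N≤n)) ⟩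
    (seq y n ℚ.+ ½ ℚ.* ε) ℚ.+ (seq v n ℚ.+ ½ ℚ.* ε)
      ≡⟨ interchange (seq y n) _ _ _ ⟩
    (seq y n ℚ.+ seq v n) ℚ.+ (½ ℚ.* ε ℚ.+ ½ ℚ.* ε)
      ≡⟨ cong (seq y n ℚ.+ seq v n ℚ.+_) (halves ε) ⟩
    (seq y n ℚ.+ seq v n) ℚ.+ ε ∎
  where open ℚ.≤-Reasoning

-ᴿ-anti-≤ᴿ : ∀ x y → x ≤ᴿ y → -ᴿ y ≤ᴿ -ᴿ x
-ᴿ-anti-≤ᴿ x y x≤y ε 0<ε with N , h ← x≤y ε 0<ε = N , λ n N≤n → begin-strict
  ℚ.- seq y n
    ≡⟨ ℚ.+-identityʳ _ ⟨
  ℚ.- seq y n ℚ.+ 0ℚ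
    ≡⟨ cong (ℚ.- seq y n ℚ.+_) (ℚ.+-inverseˡ ε) ⟨
  ℚ.- seq y n ℚ.+ (ℚ.- ε ℚ.+ ε)
    ≡⟨ ℚ.+-assoc (ℚ.- seq y n) _ _ ⟨
  (ℚ.- seq y n ℚ.- ε) ℚ.+ ε
    ≡⟨ cong (ℚ._+ ε) (ℚ.neg-distrib-+ (seq y n) ε) ⟨
  ℚ.- (seq y n ℚ.+ ε) ℚ.+ ε
    <⟨ ℚ.+-monoˡ-< ε (ℚ.neg-antimono-< (h n N≤n)) ⟩
  ℚ.- seq x n ℚ.+ ε ∎
  where open ℚ.≤-Reasoning

-- Integers inside the reals

-- `ℚ./` normalises and does not compute on a variable numerator. Among unnormalised rationals with
-- denominator 1, sums and comparisons reduce to those of the numerators.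
toℚᵘ-/1 : ∀ z → ℚ.toℚᵘ (z ℚ./ 1) ℚᵘ.≃ mkℚᵘ z 0
toℚᵘ-/1 z = ℚ.toℚᵘ-fromℚᵘ (mkℚᵘ z 0)

/1-homo-+ : ∀ w z → w ℚ./ 1 ℚ.+ z ℚ./ 1 ≡ (w ℤ.+ z) ℚ./ 1
/1-homo-+ w z = ℚ.toℚᵘ-injective (begin
  ℚ.toℚᵘ (w ℚ./ 1 ℚ.+ z ℚ./ 1)              ≈⟨ ℚ.toℚᵘ-homo-+ (w ℚ./ 1) (z ℚ./ 1) ⟩
  ℚ.toℚᵘ (w ℚ./ 1) ℚᵘ.+ ℚ.toℚᵘ (z ℚ./ 1)    ≈⟨ ℚᵘ.+-cong (toℚᵘ-/1 w) (toℚᵘ-/1 z) ⟩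
  mkℚᵘ w 0 ℚᵘ.+ mkℚᵘ z 0                    ≈⟨ *≡* (cong (ℤ._* + 1) (cong₂ ℤ._+_ (ℤ.*-identityʳ w) (ℤ.*-identityʳ z))) ⟩
  mkℚᵘ (w ℤ.+ z) 0                          ≈⟨ toℚᵘ-/1 (w ℤ.+ z) ⟨
  ℚ.toℚᵘ ((w ℤ.+ z) ℚ./ 1)                  ∎)
  where open ℚᵘ.≃-Reasoning

/1-homo-neg : ∀ z → ℚ.- (z ℚ./ 1) ≡ (ℤ.- z) ℚ./ 1
/1-homo-neg z = sym (inverseʳ-unique (z ℚ./ 1) ((ℤ.- z) ℚ./ 1)
  (trans (/1-homo-+ z (ℤ.- z)) (cong (ℚ._/ 1) (ℤ.+-inverseʳ z))))
  where open AbelianGroupProperties ℚ.+-0-abelianGroup using (inverseʳ-unique)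

/1-cancel-< : ∀ {w z} → w ℚ./ 1 ℚ.< z ℚ./ 1 → w ℤ.< z
/1-cancel-< {w} {z} w<z = subst₂ ℤ._<_ (ℤ.*-identityʳ w) (ℤ.*-identityʳ z)
  (ℚᵘ.drop-*<* (ℚᵘ.<-respʳ-≃ (toℚᵘ-/1 z) (ℚᵘ.<-respˡ-≃ (toℚᵘ-/1 w) (ℚ.toℚᵘ-mono-< w<z))))

fromℤ-cancel-≤ : ∀ {w z} → fromℤ w ≤ᴿ fromℤ z → w ℤ.≤ z
-- Tolerance 1 is enough: it gives `w < z + 1`, which over the integers means `w ≤ z`.
fromℤ-cancel-≤ {w} {z} w≤z with N , h ← w≤z 1ℚ (from-yes (0ℚ ℚ.<? 1ℚ)) =
  subst (w ℤ.≤_) (ℤ.pred-suc z) (ℤ.i<j⇒i≤pred[j] w<suc[z])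
  where
  w<suc[z] : w ℤ.< ℤ.suc z
  w<suc[z] = subst (w ℤ.<_) (ℤ.+-comm z (+ 1))
    (/1-cancel-< (subst (w ℚ./ 1 ℚ.<_) (/1-homo-+ z (+ 1)) (h N ℕ.≤-refl)))

infix 4 _≐_

-- Equivalent to x ≃ᴿ fromℤ z; the two inequalities compose without absolute values.
record _≐_ (x : ℝ) (z : ℤ) : Set where
  constructor _,_
  field
    upper : x ≤ᴿ fromℤ z
    lower : fromℤ z ≤ᴿ x

≃ᴿ-≐ : ∀ {x y z} → x ≃ᴿ y → y ≐ z → x ≐ z
≃ᴿ-≐ {x} {y} {z} x≃y (y≤z , z≤y) =
  ≤ᴿ-trans x y (fromℤ z) (≃ᴿ⇒≤ᴿ x y x≃y) y≤z ,
  ≤ᴿ-trans (fromℤ z) y x z≤y (≃ᴿ⇒≤ᴿ y x (≃ᴿ-sym x y x≃y))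

fromℤ-≐ : ∀ z → fromℤ z ≐ z
fromℤ-≐ z = ≤-refl , ≤-refl
  where
  ≤-refl : fromℤ z ≤ᴿ fromℤ z
  ≤-refl = seq-≤⇒≤ᴿ (fromℤ z) (fromℤ z) λ _ → ℚ.≤-refl

≐-cancel-≤ : ∀ {x y w z} → x ≐ w → y ≐ z → x ≤ᴿ y → w ℤ.≤ z
≐-cancel-≤ {x} {y} {w} {z} (_ , w≤x) (y≤z , _) x≤y = fromℤ-cancel-≤
  (≤ᴿ-trans (fromℤ w) x (fromℤ z) w≤x (≤ᴿ-trans x y (fromℤ z) x≤y y≤z))

≐-unique : ∀ {x w z} → x ≐ w → x ≐ z → w ≡ z
≐-unique {x} x≐w x≐z =
  ℤ.≤-antisym (≐-cancel-≤ x≐w x≐z x≤x) (≐-cancel-≤ x≐z x≐w x≤x)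
  where
  x≤x : x ≤ᴿ x
  x≤x = seq-≤⇒≤ᴿ x x λ _ → ℚ.≤-refl

-- This and the next three closure properties carry every expression built from integral path values
-- (arc flows, inflow, outflow) from ℝ to ℤ.
+ᴿ-≐ : ∀ {x y w z} → x ≐ w → y ≐ z → x +ᴿ y ≐ w ℤ.+ z
+ᴿ-≐ {x} {y} {w} {z} (x≤w , w≤x) (y≤z , z≤y) =
  ≤ᴿ-trans (x +ᴿ y) (fromℤ w +ᴿ fromℤ z) (fromℤ (w ℤ.+ z))
    (+ᴿ-mono-≤ᴿ x (fromℤ w) y (fromℤ z) x≤w y≤z)
    (seq-≤⇒≤ᴿ (fromℤ w +ᴿ fromℤ z) (fromℤ (w ℤ.+ z)) λ _ → ℚ.≤-reflexive (/1-homo-+ w z)) ,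
  ≤ᴿ-trans (fromℤ (w ℤ.+ z)) (fromℤ w +ᴿ fromℤ z) (x +ᴿ y)
    (seq-≤⇒≤ᴿ (fromℤ (w ℤ.+ z)) (fromℤ w +ᴿ fromℤ z) λ _ → ℚ.≤-reflexive (sym (/1-homo-+ w z)))
    (+ᴿ-mono-≤ᴿ (fromℤ w) x (fromℤ z) y w≤x z≤y)

-ᴿ-≐ : ∀ {x z} → x ≐ z → -ᴿ x ≐ ℤ.- z
-ᴿ-≐ {x} {z} (x≤z , z≤x) =
  ≤ᴿ-trans (-ᴿ x) (-ᴿ fromℤ z) (fromℤ (ℤ.- z))
    (-ᴿ-anti-≤ᴿ (fromℤ z) x z≤x)
    (seq-≤⇒≤ᴿ (-ᴿ fromℤ z) (fromℤ (ℤ.- z)) λ _ → ℚ.≤-reflexive (/1-homo-neg z)) ,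
  ≤ᴿ-trans (fromℤ (ℤ.- z)) (-ᴿ fromℤ z) (-ᴿ x)
    (seq-≤⇒≤ᴿ (fromℤ (ℤ.- z)) (-ᴿ fromℤ z) λ _ → ℚ.≤-reflexive (sym (/1-homo-neg z)))
    (-ᴿ-anti-≤ᴿ x (fromℤ z) x≤z)

if-≐ : ∀ c {x z} → x ≐ z → (if c then x else 0ᴿ) ≐ (if c then z else 0ℤ)
if-≐ true  x≐z = x≐z
if-≐ false _   = fromℤ-≐ 0ℤ

sum-≐ : ∀ {n} {x : Fin n → ℝ} {z : Fin n → ℤ} →
        (∀ i → x i ≐ z i) → sumᴿ x ≐ sumᶻ z
sum-≐ {ℕ.zero}  _   = fromℤ-≐ 0ℤ
sum-≐ {ℕ.suc _} x≐z = +ᴿ-≐ (x≐z zero) (sum-≐ (x≐z ∘ suc))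

-- Finite sums

open CommutativeMonoidSum ℤ.+-0-commutativeMonoid
  using (sum-cong-≗; sum-replicate-zero; ∑-comm)

if-nonNegative : ∀ c {z} → 0ℤ ℤ.≤ z → 0ℤ ℤ.≤ (if c then z else 0ℤ)
if-nonNegative true  0≤z = 0≤z
if-nonNegative false _   = ℤ.≤-refl

sum-nonNegative : ∀ {n} (f : Fin n → ℤ) → (∀ i → 0ℤ ℤ.≤ f i) → 0ℤ ℤ.≤ sumᶻ f
sum-nonNegative {ℕ.zero}  f 0≤f = ℤ.≤-refl
sum-nonNegative {ℕ.suc _} f 0≤f =
  ℤ.+-mono-≤ (0≤f zero) (sum-nonNegative (f ∘ suc) (0≤f ∘ suc))

term≤sum : ∀ {n} (f : Fin n → ℤ) → (∀ i → 0ℤ ℤ.≤ f i) → ∀ i → f i ℤ.≤ sumᶻ f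
term≤sum f 0≤f zero = subst (ℤ._≤ sumᶻ f) (ℤ.+-identityʳ (f zero))
  (ℤ.+-monoʳ-≤ (f zero) (sum-nonNegative (f ∘ suc) (0≤f ∘ suc)))
term≤sum f 0≤f (suc i) = subst (ℤ._≤ sumᶻ f) (ℤ.+-identityˡ (f (suc i)))
  (ℤ.+-mono-≤ (0≤f zero) (term≤sum (f ∘ suc) (0≤f ∘ suc) i))

sum-δ : ∀ {n} (f : Fin n → ℤ) i → sumᶻ (λ j → if does (i ≟ j) then f j else 0ℤ) ≡ f i
sum-δ {ℕ.suc n} f zero =
  trans (cong (ℤ._+_ (f zero)) (sum-replicate-zero n)) (ℤ.+-identityʳ (f zero))
sum-δ {ℕ.suc n} f (suc i) = trans (ℤ.+-identityˡ _) (sum-δ (f ∘ suc) i)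

if-swap : ∀ c d (z : ℤ) →
  (if c then (if d then z else 0ℤ) else 0ℤ) ≡ (if d then (if c then z else 0ℤ) else 0ℤ)
if-swap true  true  _ = refl
if-swap true  false _ = refl
if-swap false true  _ = refl
if-swap false false _ = refl

if-sum : ∀ c {n} (f : Fin n → ℤ) →
  (if c then sumᶻ f else 0ℤ) ≡ sumᶻ (λ i → if c then f i else 0ℤ)
if-sum true      f = refl
if-sum false {n} f = sym (sum-replicate-zero n)

-- For injective `cl` the fibres have at most one element, and this is the extension of `z` by zero
-- along `cl`.
fibreSum : ∀ {n k} → (Fin n → Fin k) → (Fin n → ℤ) → Fin k → ℤ
fibreSum cl z p = sumᶻ λ i → if does (cl i ≟ p) then z i else 0ℤ

-- Double counting: each term is spread over all classes by the indicator of its own class, and the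
-- two sums are exchanged.
sum-fibres : ∀ {n k} (cl : Fin n → Fin k) (z : Fin n → ℤ) (c : Fin k → Bool) →
  sumᶻ (λ i → if c (cl i) then z i else 0ℤ) ≡
  sumᶻ (λ p → if c p then fibreSum cl z p else 0ℤ)
sum-fibres cl z c = begin
  sumᶻ (λ i → if c (cl i) then z i else 0ℤ)
    ≡⟨ sum-cong-≗ (λ i → sum-δ (λ p → if c p then z i else 0ℤ) (cl i)) ⟨
  sumᶻ (λ i → sumᶻ λ p → if does (cl i ≟ p) then (if c p then z i else 0ℤ) else 0ℤ)
    ≡⟨ ∑-comm (λ i p → if does (cl i ≟ p) then (if c p then z i else 0ℤ) else 0ℤ) ⟩
  sumᶻ (λ p → sumᶻ λ i → if does (cl i ≟ p) then (if c p then z i else 0ℤ) else 0ℤ)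
    ≡⟨ sum-cong-≗ (λ p → sum-cong-≗ λ i → if-swap (does (cl i ≟ p)) (c p) (z i)) ⟩
  sumᶻ (λ p → sumᶻ λ i → if c p then (if does (cl i ≟ p) then z i else 0ℤ) else 0ℤ)
    ≡⟨ sum-cong-≗ (λ p → if-sum (c p) (λ i → if does (cl i ≟ p) then z i else 0ℤ)) ⟨
  sumᶻ (λ p → if c p then fibreSum cl z p else 0ℤ) ∎
  where open ≡-Reasoning

-- Search for a preimage and fall back on `default` if there is none. Injectivity ensures that the
-- preimage found is the intended one.
extendAlong : ∀ {n k} {A : Set} → A → (cl : Fin n → Fin k) → Injective _≡_ _≡_ cl →
  (g : Fin n → A) → Σ[ h ∈ (Fin k → A) ] (∀ i → h (cl i) ≡ g i)
extendAlong {k = k} {A} default cl cl-injective g = h , h∘cl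
  where
  h : Fin k → A
  h p with any? (λ i → cl i ≟ p)
  ... | yes (i , _) = g i
  ... | no _        = default

  h∘cl : ∀ i → h (cl i) ≡ g i
  h∘cl i with any? (λ j → cl j ≟ cl i)
  ... | yes (j , eq) = cong g (cl-injective eq)
  ... | no ∄         = ⊥-elim (∄ (i , refl))

-- Integral transshipments and path systems

module _ (D : Digraph) where
  open Digraph D using (#arcs; tail; head)

  -- The integer counterpart of the right-hand side of `decomposes`; `excess` likewise mirrors
  -- `balance`.
  load : ∀ {n} → (Fin n → List (Arc D)) → (Fin n → ℤ) → Arc D → ℤ
  load ps z a = sumᶻ λ i → if does (_∈?_ _≟_ a (ps i)) then z i else 0ℤ

  excess : (Arc D → ℤ) → Vertex D → ℤ
  excess f v = sumᶻ (λ a → if does (tail a ≟ v) then f a else 0ℤ)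
         ℤ.- sumᶻ (λ a → if does (head a ≟ v) then f a else 0ℤ)

  excess-cong : ∀ f g → (∀ a → f a ≡ g a) → ∀ v → excess f v ≡ excess g v
  excess-cong f g f≗g v = cong₂ ℤ._-_
    (sum-cong-≗ λ a → cong (if does (tail a ≟ v) then_else 0ℤ) (f≗g a))
    (sum-cong-≗ λ a → cong (if does (head a ≟ v) then_else 0ℤ) (f≗g a))

  load-cong : ∀ {n} (ps qs : Fin n → List (Arc D)) (y z : Fin n → ℤ) →
    (∀ i → ps i ≡ qs i) → (∀ i → y i ≡ z i) → ∀ a → load ps y a ≡ load qs z a
  load-cong ps qs y z ps≗qs y≗z a = sum-cong-≗ λ i →
    cong₂ (λ as x → if does (_∈?_ _≟_ a as) then x else 0ℤ) (ps≗qs i) (y≗z i)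

  -- The other paths through `a` have nonnegative values, so they can only add to the load.
  value≤load : ∀ {n} (ps : Fin n → List (Arc D)) (z : Fin n → ℤ) → (∀ i → 0ℤ ℤ.≤ z i) →
    ∀ {a} i → a ∈ ps i → z i ℤ.≤ load ps z a
  value≤load ps z 0≤z {a} i a∈ = subst (ℤ._≤ load ps z a)
    (cong (if_then z i else 0ℤ) (dec-true (_∈?_ _≟_ a (ps i)) a∈))
    (term≤sum (λ j → if does (_∈?_ _≟_ a (ps j)) then z j else 0ℤ)
      (λ j → if-nonNegative (does (_∈?_ _≟_ a (ps j))) (0≤z j)) i)

  -- Stated over ℤ to be decidable, which allows an exhaustive search on a concrete network.
  Respects : (Arc D → ℕ) → (Vertex D → ℤ) → (Arc D → ℤ) → Set
  Respects c b f = (∀ a → f a ℤ.≤ + c a) × (∀ v → excess f v ≡ b v)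

  respects? : ∀ c b f → Dec (Respects c b f)
  respects? c b f =
    all? (λ a → f a ℤ.≤? + c a) ×-dec all? (λ v → excess f v ℤ.≟ b v)

  Respects-cong : ∀ c b f g → (∀ a → f a ≡ g a) → Respects c b f → Respects c b g
  Respects-cong c b f g f≗g (f≤c , f-b) =
    (λ a → subst (ℤ._≤ + c a) (f≗g a) (f≤c a)) ,
    (λ v → trans (sym (excess-cong f g f≗g v)) (f-b v))

  module _ {b} (y : UnsplittableTransshipment D b) where
    open UnsplittableTransshipment y using (#paths; path; value)
    private
      module T = IsTransshipment (isTransshipment y)
      module P = PathDecomposition (decomposition y)

    -- Arc flows and net outflows are sums and differences of path values, so they equal the same
    -- expressions in the integers `z`. Inequalities and equalities between integers seen as reals
    -- then descend to ℤ.
    integral⇒respects : ∀ {c} → IsFeasible D c (flow y) → IsIntegralUnsplittable D y →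
      Σ[ z ∈ (Fin #paths → ℤ) ]
        ( (∀ i → 0ℤ ℤ.≤ z i) × Respects c b (load (λ i → arcs (path i)) z))
    integral⇒respects {c} feasible integral =
      z ,
      (λ i → ≐-cancel-≤ (fromℤ-≐ 0ℤ) (value≐z i) (P.nonNegative i)) ,
      (λ a → ≐-cancel-≤ (flow≐load a) (fromℤ-≐ (+ c a)) (feasible a)) ,
      (λ v → ≐-unique (net≐excess v) (≃ᴿ-≐ (T.balance v) (fromℤ-≐ (b v))))
      where
      z : Fin #paths → ℤ
      z i = proj₁ (integral i)

      value≐z : ∀ i → value i ≐ z i
      value≐z i = ≃ᴿ-≐ (proj₂ (integral i)) (fromℤ-≐ (z i))

      flow≐load : ∀ a → flow y a ≐ load (λ i → arcs (path i)) z a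
      flow≐load a = ≃ᴿ-≐ (P.decomposes a)
        (sum-≐ λ i → if-≐ (does (_∈?_ _≟_ a (arcs (path i)))) (value≐z i))

      net≐excess : ∀ v → outflow D (flow y) v -ᴿ inflow D (flow y) v
                       ≐ excess (load (λ i → arcs (path i)) z) v
      net≐excess v = +ᴿ-≐
        (sum-≐ λ a → if-≐ (does (tail a ≟ v)) (flow≐load a))
        (-ᴿ-≐ (sum-≐ λ a → if-≐ (does (head a ≟ v)) (flow≐load a)))

-- The example

-- Vertices are numbered in layers: sources 0, 1; gate entrances 2, 3; gate exits 4, 5; sinks 6, 7.
-- Each arc leads from one layer to the next.
network : Digraph
network = record
  { #vertices = 8
  ; #arcs     = 10
  ; tail = Vec.lookup (0F ∷ 0F ∷ 1F ∷ 1F ∷ 2F ∷ 3F ∷ 4F ∷ 4F ∷ 5F ∷ 5F ∷ [])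
  ; head = Vec.lookup (2F ∷ 3F ∷ 2F ∷ 3F ∷ 4F ∷ 5F ∷ 6F ∷ 7F ∷ 6F ∷ 7F ∷ [])
  }

open Digraph network using (tail; head)

capacity : Arc network → ℕ
capacity = Vec.lookup (2 ∷ 2 ∷ 2 ∷ 2 ∷ 3 ∷ 3 ∷ 2 ∷ 2 ∷ 2 ∷ 2 ∷ [])

supply : Vertex network → ℤ
supply = Vec.lookup
  (+ 3 ∷ + 3 ∷ 0ℤ ∷ 0ℤ ∷ 0ℤ ∷ 0ℤ ∷ -[1+ 2 ] ∷ -[1+ 2 ] ∷ [])

source sink entrance exit : Fin 2 → Vertex network
source   = Vec.lookup (0F ∷ 1F ∷ [])
entrance = Vec.lookup (2F ∷ 3F ∷ [])
exit     = Vec.lookup (4F ∷ 5F ∷ [])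
sink     = Vec.lookup (6F ∷ 7F ∷ [])

enter leave : Fin 2 → Fin 2 → Arc network
enter s m = Vec.lookup (Vec.lookup ((0F ∷ 1F ∷ []) ∷ (2F ∷ 3F ∷ []) ∷ []) s) m
leave m t = Vec.lookup (Vec.lookup ((6F ∷ 7F ∷ []) ∷ (8F ∷ 9F ∷ []) ∷ []) m) t

gate : Fin 2 → Arc network
gate = Vec.lookup (4F ∷ 5F ∷ [])

route : Fin 2 → Fin 2 → Fin 2 → List (Arc network)
route s m t = enter s m ∷ gate m ∷ leave m t ∷ []

-- Walks from sources to sinks

out-source : ∀ s a → tail a ≡ source s → ∃[ m ] a ≡ enter s m
out-source = from-yes (all? λ s → all? λ a →
  (tail a ≟ source s) →-dec any? λ m → a ≟ enter s m)

out-entrance : ∀ m a → tail a ≡ entrance m → a ≡ gate m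
out-entrance = from-yes (all? λ m → all? λ a →
  (tail a ≟ entrance m) →-dec (a ≟ gate m))

out-exit : ∀ m a → tail a ≡ exit m → ∃[ t ] a ≡ leave m t
out-exit = from-yes (all? λ m → all? λ a →
  (tail a ≟ exit m) →-dec any? λ t → a ≟ leave m t)

out-sink : ∀ t a → ¬ tail a ≡ sink t
out-sink = from-yes (all? λ t → all? λ a → ¬? (tail a ≟ sink t))

head-enter : ∀ s m → head (enter s m) ≡ entrance m
head-enter = from-yes (all? λ s → all? λ m → head (enter s m) ≟ entrance m)

head-gate : ∀ m → head (gate m) ≡ exit m
head-gate = from-yes (all? λ m → head (gate m) ≟ exit m)

head-leave : ∀ m t → head (leave m t) ≡ sink t
head-leave = from-yes (all? λ m → all? λ t → head (leave m t) ≟ sink t)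

source≢sink : ∀ s t → ¬ source s ≡ sink t
source≢sink = from-yes (all? λ s → all? λ t → ¬? (source s ≟ sink t))

entrance≢sink : ∀ m t → ¬ entrance m ≡ sink t
entrance≢sink = from-yes (all? λ m → all? λ t → ¬? (entrance m ≟ sink t))

exit≢sink : ∀ m t → ¬ exit m ≡ sink t
exit≢sink = from-yes (all? λ m → all? λ t → ¬? (exit m ≟ sink t))

sink-injective : ∀ t u → sink t ≡ sink u → t ≡ u
sink-injective = from-yes (all? λ t → all? λ u → (sink t ≟ sink u) →-dec (t ≟ u))

isSource : ∀ v → Source network supply v → ∃[ s ] v ≡ source s
isSource = from-yes (all? λ v → (0ℤ ℤ.<? supply v) →-dec any? λ s → v ≟ source s)

isSink : ∀ v → Sink network supply v → ∃[ t ] v ≡ sink t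
isSink = from-yes (all? λ v → (supply v ℤ.<? 0ℤ) →-dec any? λ t → v ≟ sink t)

-- The walks are determined layer by layer, starting at the sinks, which no arc leaves. The start is
-- a variable `v` with an equation because the head of an arc such as `leave m u` does not reduce to
-- a sink while the indices are variables.
walkFromSink : ∀ {v} t {u} as → v ≡ sink t → IsWalk network v as (sink u) → t ≡ u × as ≡ []
walkFromSink t {u} [] refl w = sink-injective t u w , refl
walkFromSink t (a ∷ _) refl (p , _) = ⊥-elim (out-sink t a p)

walkFromExit : ∀ {v} m {t} as → v ≡ exit m → IsWalk network v as (sink t) →
  as ≡ leave m t ∷ []
walkFromExit m {t} [] refl w = ⊥-elim (exit≢sink m t w)
walkFromExit m {t} (a ∷ as) refl (p , w)
  with u , refl ← out-exit m a p
  with refl , refl ← walkFromSink u {t} as (head-leave m u) w = refl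

walkFromEntrance : ∀ {v} m {t} as → v ≡ entrance m → IsWalk network v as (sink t) →
  as ≡ gate m ∷ leave m t ∷ []
walkFromEntrance m {t} [] refl w = ⊥-elim (entrance≢sink m t w)
walkFromEntrance m {t} (a ∷ as) refl (p , w)
  with refl ← out-entrance m a p = cong (gate m ∷_) (walkFromExit m {t} as (head-gate m) w)

-- Once the terminals are fixed, the gate is the only freedom left to a path.
walkFromSource : ∀ s {t} as → IsWalk network (source s) as (sink t) →
  ∃[ m ] as ≡ route s m t
walkFromSource s {t} [] w = ⊥-elim (source≢sink s t w)
walkFromSource s {t} (a ∷ as) (p , w)
  with m , refl ← out-source s a p =
    m , cong (enter s m ∷_) (walkFromEntrance m {t} as (head-enter s m) w)

-- p : Fin 4 encodes the source–sink pair (quotient p , remainder p).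
terminals : Fin 4 → Vertex network × Vertex network
terminals p = source (quotient 2 p) , sink (remainder {2} 2 p)

pairRoute : Fin 2 → Fin 4 → List (Arc network)
pairRoute m p = route (quotient 2 p) m (remainder {2} 2 p)

classify : (P : Path network) →
  Source network supply (start P) → Sink network supply (end P) →
  Σ[ p ∈ Fin 4 ] Σ[ m ∈ Fin 2 ]
    ((start P , end P) ≡ terminals p × arcs P ≡ pairRoute m p)
classify record { start = v ; end = w ; arcs = as ; isWalk = walk } v-source w-sink
  with s , refl ← isSource v v-source | t , refl ← isSink w w-sink
  with m , refl ← walkFromSource s {t} as walk =
    combine s t , m ,
    cong (λ (s , t) → source s , sink t) (sym (remQuot-combine s t)) ,
    cong (λ (s , t) → route s m t) (sym (remQuot-combine s t))

-- Excluding integral solutions by finite search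

splitFlow : Fin (2 ^ 4) → Fin (3 ^ 4) → Arc network → ℤ
splitFlow g x = load network (λ p → pairRoute (finToFun {2} g p) p) (λ p → + toℕ (finToFun {3} x p))

-- Evaluation of all 16 gate choices combined with all 81 assignments of values 0, 1, 2 to the four
-- pairs. Both functions are coded as elements of a `Fin` so that `all?` can range over them.
noSplitFlow : ∀ g x → ¬ Respects network capacity supply (splitFlow g x)
noSplitFlow = from-yes (all? λ g → all? λ x →
  ¬? (respects? network capacity supply (splitFlow g x)))

0≤z≤2⇒digit : ∀ {z} → 0ℤ ℤ.≤ z → z ℤ.≤ + 2 → Σ[ d ∈ Fin 3 ] z ≡ + toℕ d
0≤z≤2⇒digit {+ n} _ (ℤ.+≤+ n≤2) = fromℕ< (s≤s n≤2) , cong +_ (sym (toℕ-fromℕ< (s≤s n≤2)))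

-- Passing the parts of the triple as arguments rather than by a with-abstraction
-- keeps the sums in Respects from being unfolded over the concrete network.
respects⇒⊥ : (y : UnsplittableTransshipment network supply) →
  let open UnsplittableTransshipment y using (#paths; path) in
  (z : Fin #paths → ℤ) → (∀ i → 0ℤ ℤ.≤ z i) →
  Respects network capacity supply (load network (λ i → arcs (path i)) z) → ⊥
respects⇒⊥ y z 0≤z respects =
  noSplitFlow (funToFin gateOf) (funToFin digit)
    (Respects-cong network capacity supply
      (load network (λ i → arcs (path i)) z) (splitFlow (funToFin gateOf) (funToFin digit))
      load≗splitFlow respects)
  where
  open UnsplittableTransshipment y using (#paths; path)

  class : ∀ i → _
  class i = classify (path i) (fromSource y i) (toSink y i)

  pair : Fin #paths → Fin 4
  pair i = proj₁ (class i)

  -- Unsplittability enters here: paths with the same code have the same endpoints.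
  pair-injective : Injective _≡_ _≡_ pair
  pair-injective {i} {j} eq = onePathPerPair y
    (trans (proj₁ (proj₂ (proj₂ (class i))))
      (trans (cong terminals eq) (sym (proj₁ (proj₂ (proj₂ (class j)))))))

  extension : Σ[ h ∈ (Fin 4 → Fin 2) ] (∀ i → h (pair i) ≡ proj₁ (proj₂ (class i)))
  -- A pair without a path gets gate `0F`; its value `X` is an empty sum, so this adds no load.
  extension = extendAlong 0F pair pair-injective (λ i → proj₁ (proj₂ (class i)))

  gateOf : Fin 4 → Fin 2
  gateOf = proj₁ extension

  X : Fin 4 → ℤ
  X = fibreSum pair z

  0≤X : ∀ p → 0ℤ ℤ.≤ X p
  0≤X p = sum-nonNegative _ λ i → if-nonNegative (does (pair i ≟ p)) (0≤z i)

  -- Replaces the unknown number of paths by exactly one route for each of the four pairs.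
  load≗X : ∀ a → load network (λ i → arcs (path i)) z a
               ≡ load network (λ p → pairRoute (gateOf p) p) X a
  load≗X a = trans
    (load-cong network (λ i → arcs (path i)) (λ i → pairRoute (gateOf (pair i)) (pair i)) z z
      (λ i → trans (proj₂ (proj₂ (proj₂ (class i))))
        (cong (λ m → pairRoute m (pair i)) (sym (proj₂ extension i))))
      (λ _ → refl) a)
    (sum-fibres pair z λ p → does (_∈?_ _≟_ a (pairRoute (gateOf p) p)))

  capacity-enter : ∀ s m → capacity (enter s m) ≡ 2
  capacity-enter = from-yes (all? λ s → all? λ m → capacity (enter s m) ℕ.≟ 2)

  -- The first arc of the route of `p` has capacity 2 and carries at least `X p`. This bound makes
  -- the set of candidate values finite.
  X≤2 : ∀ p → X p ℤ.≤ + 2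
  X≤2 p = ℤ.≤-trans
    (value≤load network (λ p → pairRoute (gateOf p) p) X 0≤X p (here refl))
    (subst₂ ℤ._≤_ (load≗X a) (cong +_ (capacity-enter (quotient 2 p) (gateOf p)))
      (proj₁ respects a))
    where
    a = enter (quotient 2 p) (gateOf p)

  digit : Fin 4 → Fin 3
  digit p = proj₁ (0≤z≤2⇒digit (0≤X p) (X≤2 p))

  load≗splitFlow : ∀ a → load network (λ i → arcs (path i)) z a
                       ≡ splitFlow (funToFin gateOf) (funToFin digit) a
  load≗splitFlow a = trans (load≗X a) (load-cong network
    (λ p → pairRoute (gateOf p) p) (λ p → pairRoute (finToFun (funToFin gateOf) p) p)
    X (λ p → + toℕ (finToFun (funToFin digit) p))
    (λ p → cong (λ m → pairRoute m p) (sym (finToFun-funToFin gateOf p)))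
    (λ p → trans (proj₂ (0≤z≤2⇒digit (0≤X p) (X≤2 p)))
                 (cong (λ d → + toℕ d) (sym (finToFun-funToFin digit p))))
    a)

noIntegral : ¬ (Σ[ y ∈ UnsplittableTransshipment network supply ]
  (IsFeasible network capacity (flow y) × IsIntegralUnsplittable network y))
noIntegral (y , feasible , integral) =
  respects⇒⊥ y (proj₁ integers) (proj₁ (proj₂ integers)) (proj₂ (proj₂ integers))
  where
  integers = integral⇒respects network y feasible integral

-- The half-integral solution

routePath : Fin 2 → Fin 2 → Fin 2 → Path network
routePath s m t = record
  { start  = source s
  ; end    = sink t
  ; arcs   = route s m t
  -- Decided for all indices at once and then instantiated, since the decision does not reduce while
  -- `s`, `m`, `t` are variables.
  ; isWalk = from-yes (all? λ s → all? λ m → all? λ t →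
      (tail (enter s m) ≟ source s) ×-dec (tail (gate m) ≟ head (enter s m)) ×-dec
      (tail (leave m t) ≟ head (gate m)) ×-dec (head (leave m t) ≟ sink t)) s m t
  ; simple = from-yes (all? λ s → all? λ m → all? λ t →
      unique? _≟_ (source s ∷ map head (route s m t))) s m t
  }

-- Each terminal splits its 3 units equally between its two pairs. With the crosswise gates, each
-- gate carries two paths and is saturated, while every other arc carries one path, and 3/2 is below
-- 2.
3/2 : ℚ
3/2 = + 3 ℚ./ 2

-- (sᵢ , tᵢ) uses the first gate and (sᵢ , t₁₋ᵢ) the second.
crossing : Fin 4 → Fin 2
crossing = Vec.lookup (0F ∷ 1F ∷ 1F ∷ 0F ∷ [])

pairPath : Fin 4 → Path network
pairPath p = routePath (quotient 2 p) (crossing p) (remainder {2} 2 p)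

halfIntegralFlow : Arc network → ℝ
halfIntegralFlow a = sumᴿ λ p →
  if does (_∈?_ _≟_ a (arcs (pairPath p))) then fromℚ 3/2 else 0ᴿ

halfIntegral : UnsplittableTransshipment network supply
halfIntegral = record
  { flow = halfIntegralFlow
  ; isTransshipment = record
    -- All reals involved are constant sequences, so one rational check over the arcs settles every
    -- index `n`.
    { nonNegative = λ a → seq-≤⇒≤ᴿ 0ᴿ (halfIntegralFlow a) λ n →
        from-yes (all? λ a → 0ℚ ℚ.≤? seq (halfIntegralFlow a) n) a
    ; balance = λ v → seq-≡⇒≃ᴿ
        (outflow network halfIntegralFlow v -ᴿ inflow network halfIntegralFlow v)
        (fromℤ (supply v)) λ n →
        from-yes (all? λ v →
          seq (outflow network halfIntegralFlow v -ᴿ inflow network halfIntegralFlow v) n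
            ℚ.≟ supply v ℚ./ 1) v
    }
  ; decomposition = record
    { #paths      = 4
    ; path        = pairPath
    ; value       = λ _ → fromℚ 3/2
    ; nonNegative = λ _ → seq-≤⇒≤ᴿ 0ᴿ (fromℚ 3/2) λ _ → from-yes (0ℚ ℚ.≤? 3/2)
    -- The flow was defined as this very sum over the four paths.
    ; decomposes  = λ a → seq-≡⇒≃ᴿ (halfIntegralFlow a) (halfIntegralFlow a) λ _ → refl
    }
  ; fromSource     = from-yes (all? λ p → 0ℤ ℤ.<? supply (start (pairPath p)))
  ; toSink         = from-yes (all? λ p → supply (end (pairPath p)) ℤ.<? 0ℤ)
  ; onePathPerPair = λ {p} {q} → from-yes (all? λ p → all? λ q →
      ≡-dec _≟_ _≟_ (terminals p) (terminals q) →-dec (p ≟ q)) p q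
  }

halfIntegral-feasible : IsFeasible network capacity halfIntegralFlow
halfIntegral-feasible a = seq-≤⇒≤ᴿ (halfIntegralFlow a) (fromℤ (+ capacity a)) λ n →
  from-yes (all? λ a → seq (halfIntegralFlow a) n ℚ.≤? + capacity a ℚ./ 1) a

mainTheorem9 : Σ[ D ∈ Digraph ] Σ[ c ∈ (Arc D → ℕ) ] Σ[ b ∈ (Vertex D → ℤ) ]
    ( sumᶻ b ≡ 0ℤ
    × (Σ[ y ∈ UnsplittableTransshipment D b ] IsFeasible D c (flow y))
    × ¬ (Σ[ y ∈ UnsplittableTransshipment D b ]
    (IsFeasible D c (flow y) × IsIntegralUnsplittable D y)) )
mainTheorem9 = network , capacity , supply , refl , (halfIntegral , halfIntegral-feasible) , noIntegral
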